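{- For every positive integer $n$, there exists a positive integer $k$ such that $\nu(k)=n$.
   Context: Let $F(x,y,z)=x^3+y^3+z^3-3xyz$. For a positive integer $m$, $\nu(m)$ denotes the number of triples of integers $(x,y,z)$ with $0\leq x\leq y\leq z$ and $z\geq x+1$ such that $F(x,y,z)=m$. -}

module Defs where

open import Axiom.UniquenessOfIdentityProofs using (module Decidable⇒UIP)
open import Data.Fin using (Fin)
open import Data.Fin.Permutation using (↔⇒≡)
open import Data.Integer using (ℤ; +_; _+_; _-_; _*_; _^_; _≤_; _≥_)
open import Data.Integer.Properties using (≤-irrelevant; _≟_)
open import Data.Nat using (ℕ)
open import Data.Product using (_×_; _,_)
open import Function.Bundles using (_↔_)
open import Function.Properties.Inverse using (↔-sym; ↔-trans)
open import Relation.Binary.PropositionalEquality using (_≡_; refl)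

F : ℤ → ℤ → ℤ → ℤ
F x y z = x ^ 3 + y ^ 3 + z ^ 3 - + 3 * x * y * z

record Solution (m : ℕ) : Set where
  constructor solution
  field
    x y z : ℤ
    0≤x   : + 0 ≤ x
    x≤y   : x ≤ y
    y≤z   : y ≤ z
    z≥x+1 : z ≥ x + + 1
    F≡m   : F x y z ≡ + m

-- A Solution carries proofs; they add no multiplicity, so counting
-- Solutions is counting triples of integers.

triple : ∀ {m} → Solution m → ℤ × ℤ × ℤ
triple s = Solution.x s , Solution.y s , Solution.z s

triple-injective : ∀ {m} {s t : Solution m} → triple s ≡ triple t → s ≡ t
triple-injective {s = solution x y z a b c d e} {solution _ _ _ a′ b′ c′ d′ e′} refl
  with refl ← ≤-irrelevant a a′
     | refl ← ≤-irrelevant b b′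
     | refl ← ≤-irrelevant c c′
     | refl ← ≤-irrelevant d d′
     | refl ← Decidable⇒UIP.≡-irrelevant _≟_ e e′
  = refl

-- ν is given by its graph: ν[ m ]≡ n says that the set of triples counted
-- by ν(m) is finite and has exactly n elements.

ν[_]≡_ : ℕ → ℕ → Set
ν[ m ]≡ n = Fin n ↔ Solution m

ν-functional : ∀ {m n n′} → ν[ m ]≡ n → ν[ m ]≡ n′ → n ≡ n′
ν-functional p q = ↔⇒≡ (↔-trans p (↔-sym q))

{-# OPTIONS --safe #-}

-- With y = x + a and z = y + b, F factors as (3x + 2a + b)(a² + ab + b²).
-- Take k = 8ᴺ.  Both factors are powers of 2, and a² + ab + b² is even only
-- when a and b both are.  If it is odd it equals 1, so {a, b} = {0, 1}, and
-- exactly one such triple exists, since 8ᴺ is 1 or 2 modulo 3.  If it is even,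
-- 3x + 2a + b is at least 2, hence even, so x is even too and the triple is
-- twice a triple for 8ᴺ⁻¹.  By induction ν(8ᴺ) = N + 1.

module Submission where

open import Defs
open import Data.Empty using (⊥-elim)
open import Data.Fin using (Fin; zero; suc)
open import Data.Integer as ℤ using (ℤ; +_; +≤+)
import Data.Integer.Properties as ℤ
import Data.Integer.Tactic.RingSolver as ℤSolver
open import Data.Nat using (ℕ; zero; suc; _+_; _*_; _^_; _%_; _≤_; _>_; z≤n; s≤s; NonZero; ≢-nonZero⁻¹)
open import Data.Nat.Coprimality using (Coprime; coprime-divisor)
open import Data.Nat.Divisibility using (_∣_; m∣m*n; n∣m*n; ∣1⇒≡1; ∣m+n∣m⇒∣n; ∣m⇒∣m*n)
open import Data.Nat.DivMod using (_divMod_; result; [m+kn]%n≡m%n)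
open import Data.Nat.Properties
open import Data.Nat.Tactic.RingSolver using (solve-∀)
open import Data.Product using (∃-syntax; Σ-syntax; _×_; _,_; map; proj₁; proj₂)
open import Data.Sum using (_⊎_; inj₁; inj₂)
open import Function using (_∘_)
open import Function.Bundles using (mk⤖; _↔_)
open import Function.Consequences.Propositional using (strictlySurjective⇒surjective)
open import Function.Definitions using (Injective; StrictlySurjective)
open import Function.Properties.Bijection using (⤖⇒↔)
open import Function.Properties.Inverse using (↔-trans)
open import Relation.Binary.PropositionalEquality
open import Relation.Nullary using (¬_; contradiction)

q : ℕ → ℕ → ℕ
q a b = a * a + a * b + b * b

form : ℕ → ℕ → ℕ → ℕ
form x a b = (3 * x + 2 * a + b) * q a b

-- The differences `a = y - x` and `b = z - y` absorb the order conditions, as all coordinates are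
-- naturals. The condition `z ≥ x + 1` is recovered from `m` being nonzero.
Rep : ℕ → Set
Rep m = Σ[ (x , a , b) ∈ ℕ × ℕ × ℕ ] form x a b ≡ m

rep-≡ : ∀ {m} {r s : Rep m} → proj₁ r ≡ proj₁ s → r ≡ s
rep-≡ {r = t , e} {_ , e′} refl = cong (t ,_) (≡-irrelevant e e′)

-- Abstract because with-abstraction over a Solution would otherwise normalise
-- the solver's proof term, which takes too long.
abstract
  F-factors : ∀ x a b → F (+ x) (+ (x + a)) (+ (x + a + b)) ≡ + form x a b
  F-factors x a b = trans (identity (+ x) (+ a) (+ b)) (sym cast)
    where
    -- The cubes are unfolded because the solver does not reify ℤ._^_.
    identity : ∀ x a b →
      x ℤ.* (x ℤ.* (x ℤ.* + 1))
        ℤ.+ (x ℤ.+ a) ℤ.* ((x ℤ.+ a) ℤ.* ((x ℤ.+ a) ℤ.* + 1))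
        ℤ.+ (x ℤ.+ a ℤ.+ b) ℤ.* ((x ℤ.+ a ℤ.+ b) ℤ.* ((x ℤ.+ a ℤ.+ b) ℤ.* + 1))
        ℤ.+ ℤ.- (+ 3 ℤ.* x ℤ.* (x ℤ.+ a) ℤ.* (x ℤ.+ a ℤ.+ b))
      ≡ (+ 3 ℤ.* x ℤ.+ + 2 ℤ.* a ℤ.+ b) ℤ.* (a ℤ.* a ℤ.+ a ℤ.* b ℤ.+ b ℤ.* b)
    identity = ℤSolver.solve-∀

    cast : + form x a b ≡ (+ 3 ℤ.* + x ℤ.+ + 2 ℤ.* + a ℤ.+ + b)
      ℤ.* (+ a ℤ.* + a ℤ.+ + a ℤ.* + b ℤ.+ + b ℤ.* + b)
    cast = trans (ℤ.pos-* (3 * x + 2 * a + b) (q a b))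
      (cong₂ ℤ._*_
        (cong (ℤ._+ + b) (cong₂ ℤ._+_ (ℤ.pos-* 3 x) (ℤ.pos-* 2 a)))
        (cong₂ ℤ._+_ (cong₂ ℤ._+_ (ℤ.pos-* a a) (ℤ.pos-* a b)) (ℤ.pos-* b b)))

a+b>0 : ∀ {m} .{{_ : NonZero m}} x a b → form x a b ≡ m → 1 ≤ a + b
a+b>0 {m} x zero zero e = ⊥-elim (≢-nonZero⁻¹ m (trans (sym e) (*-zeroʳ (3 * x + 0 + 0))))
a+b>0 x zero (suc b) e = s≤s z≤n
a+b>0 x (suc a) b e = s≤s z≤n

rep→solution : ∀ {m} .{{_ : NonZero m}} → Rep m → Solution m
rep→solution ((x , a , b) , e) = solution (+ x) (+ (x + a)) (+ (x + a + b))
  (+≤+ z≤n) (+≤+ (m≤m+n x a)) (+≤+ (m≤m+n (x + a) b))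
  (+≤+ (≤-trans (+-monoʳ-≤ x (a+b>0 x a b e)) (≤-reflexive (sym (+-assoc x a b)))))
  (trans (F-factors x a b) (cong +_ e))

rep→solution-injective : ∀ {m} .{{_ : NonZero m}} → Injective _≡_ _≡_ (rep→solution {m})
rep→solution-injective {x = (x , a , b) , _} {(x′ , a′ , b′) , _} eq
  with refl ← ℤ.+-injective (cong Solution.x eq)
  with refl ← +-cancelˡ-≡ x a a′ (ℤ.+-injective (cong Solution.y eq))
  with refl ← +-cancelˡ-≡ (x + a) b b′ (ℤ.+-injective (cong Solution.z eq))
  = rep-≡ refl

rep→solution-surjective : ∀ {m} .{{_ : NonZero m}} → StrictlySurjective _≡_ (rep→solution {m})
rep→solution-surjective (solution (+ x) (+ y) (+ z) (+≤+ _) (+≤+ x≤y) (+≤+ y≤z) _ e)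
  with a , refl ← m≤n⇒∃[o]m+o≡n x≤y
  with b , refl ← m≤n⇒∃[o]m+o≡n y≤z
  = ((x , a , b) , ℤ.+-injective (trans (sym (F-factors x a b)) e)) , triple-injective refl

Rep↔Solution : ∀ m .{{_ : NonZero m}} → Rep m ↔ Solution m
Rep↔Solution m = ⤖⇒↔ (mk⤖ {to = rep→solution} (rep→solution-injective ,
  strictlySurjective⇒surjective rep→solution-surjective))

-- An odd number is coprime to 2, so the factors 2 can be stripped one at a time until it divides 1.
odd-divisor-of-2^ : ∀ t j → 1 + t * 2 ∣ 2 ^ j → t ≡ 0
odd-divisor-of-2^ t j d = m*n≡0⇒m≡0 t 2 (suc-injective (∣1⇒≡1 (strip j d)))
  where
  coprime-to-2 : Coprime (1 + t * 2) 2
  coprime-to-2 {c} (c∣1+2t , c∣2) = ∣1⇒≡1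
    (∣m+n∣m⇒∣n (subst (c ∣_) (trans (+-comm 1 (t * 2)) (cong (_+ 1) (*-comm t 2))) c∣1+2t)
      (∣m⇒∣m*n t c∣2))

  strip : ∀ j → 1 + t * 2 ∣ 2 ^ j → 1 + t * 2 ∣ 1
  strip zero    d = d
  strip (suc j) d = strip j (coprime-divisor coprime-to-2 d)

odd-divisor-of-8^ : ∀ t N → 1 + t * 2 ∣ 8 ^ N → t ≡ 0
odd-divisor-of-8^ t N d = odd-divisor-of-2^ t (3 * N) (subst (_ ∣_) (^-*-assoc 2 3 N) d)

data QParity : ℕ → ℕ → Set where
  even : ∀ a b → QParity (a * 2) (b * 2)
  odd  : ∀ {a b} t → q a b ≡ 1 + t * 2 → QParity a b

-- Over the field with two elements `q` vanishes only at the origin. Each odd case exhibits half of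
-- `q a b - 1`, the form in which `odd-divisor-of-8^` takes it.
q-parity : ∀ a b → QParity a b
q-parity a b with a divMod 2 | b divMod 2
... | result a zero refl       | result b zero refl       = even a b
... | result a zero refl       | result b (suc zero) refl =
  odd (2 * a * a + a * (1 + b * 2) + 2 * b * b + 2 * b) (identity a b)
  where
  identity : ∀ a b → a * 2 * (a * 2) + a * 2 * (1 + b * 2) + (1 + b * 2) * (1 + b * 2)
    ≡ 1 + (2 * a * a + a * (1 + b * 2) + 2 * b * b + 2 * b) * 2
  identity = solve-∀
... | result a (suc zero) refl | result b zero refl       =
  odd (2 * b * b + b * (1 + a * 2) + 2 * a * a + 2 * a) (identity a b)
  where
  identity : ∀ a b → (1 + a * 2) * (1 + a * 2) + (1 + a * 2) * (b * 2) + b * 2 * (b * 2)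
    ≡ 1 + (2 * b * b + b * (1 + a * 2) + 2 * a * a + 2 * a) * 2
  identity = solve-∀
... | result a (suc zero) refl | result b (suc zero) refl =
  odd (2 * a * a + 3 * a + 2 * a * b + 3 * b + 2 * b * b + 1) (identity a b)
  where
  identity : ∀ a b →
    (1 + a * 2) * (1 + a * 2) + (1 + a * 2) * (1 + b * 2) + (1 + b * 2) * (1 + b * 2)
    ≡ 1 + (2 * a * a + 3 * a + 2 * a * b + 3 * b + 2 * b * b + 1) * 2
  identity = solve-∀

q≡1⇒a+b≡1 : ∀ a b → q a b ≡ 1 → a + b ≡ 1
q≡1⇒a+b≡1 zero          (suc zero)    _ = refl
q≡1⇒a+b≡1 (suc zero)    zero          _ = refl
-- Here `q` is 0; in the remaining cases it is at least 3, and evaluation exposes two successors.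
q≡1⇒a+b≡1 zero          zero          ()
q≡1⇒a+b≡1 zero          (suc (suc b)) ()
q≡1⇒a+b≡1 (suc zero)    (suc b)       ()
q≡1⇒a+b≡1 (suc (suc a)) b             ()

double≢1 : ∀ a b → ¬ a * 2 + b * 2 ≡ 1
double≢1 a b e with a + b | trans (*-distribʳ-+ 2 a b) e
... | zero  | ()
... | suc _ | ()

form-0-1 : ∀ x → form x 0 1 ≡ 1 + x * 3
form-0-1 = identity
  where
  identity : ∀ x → (3 * x + 0 + 1) * 1 ≡ 1 + x * 3
  identity = solve-∀

form-1-0 : ∀ x → form x 1 0 ≡ 2 + x * 3
form-1-0 = identity
  where
  identity : ∀ x → (3 * x + 2 + 0) * 1 ≡ 2 + x * 3
  identity = solve-∀

1+3x≢2+3y : ∀ x y → ¬ 1 + x * 3 ≡ 2 + y * 3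
1+3x≢2+3y x y e with () ← trans (sym ([m+kn]%n≡m%n 1 x 3)) (trans (cong (_% 3) e) ([m+kn]%n≡m%n 2 y 3))

Primitive : ∀ {m} → Rep m → Set
Primitive ((_ , a , b) , _) = a + b ≡ 1

-- The residue of `m` modulo 3 decides between `(0 , 1)` and `(1 , 0)`, and then `m` determines `x`
-- linearly.
primitive-unique : ∀ {m} (r s : Rep m) → Primitive r → Primitive s → r ≡ s
primitive-unique ((x , zero , b) , e) ((y , zero , b′) , e′) refl refl =
  rep-≡ (cong (λ w → w , 0 , 1) (*-cancelʳ-≡ x y 3 (suc-injective
    (trans (sym (form-0-1 x)) (trans e (trans (sym e′) (form-0-1 y)))))))
primitive-unique ((x , zero , b) , e) ((y , suc zero , zero) , e′) refl refl =
  ⊥-elim (1+3x≢2+3y x y (trans (sym (form-0-1 x)) (trans e (trans (sym e′) (form-1-0 y)))))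
primitive-unique ((x , suc zero , zero) , e) ((y , zero , b′) , e′) refl refl =
  ⊥-elim (1+3x≢2+3y y x (trans (sym (form-0-1 y)) (trans e′ (trans (sym e) (form-1-0 x)))))
primitive-unique ((x , suc zero , zero) , e) ((y , suc zero , zero) , e′) refl refl =
  rep-≡ (cong (λ w → w , 1 , 0) (*-cancelʳ-≡ x y 3 (suc-injective (suc-injective
    (trans (sym (form-1-0 x)) (trans e (trans (sym e′) (form-1-0 y))))))))

-- Since 8 is 2 modulo 3, multiplying by 8 swaps the residues 1 and 2, so the two primitive shapes
-- alternate with `N`.
∃-primitive : ∀ N → Σ[ r ∈ Rep (8 ^ N) ] Primitive r
∃-primitive zero    = ((0 , 0 , 1) , refl) , refl
∃-primitive (suc N) with ∃-primitive N
-- From 8(3x + 1) = 3(8x + 2) + 2.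
... | ((x , zero , b) , e) , refl = ((8 * x + 2 , 1 , 0) , trans (identity x) (cong (8 *_) e)) , refl
  where
  identity : ∀ x → (3 * (8 * x + 2) + 2 + 0) * 1 ≡ 8 * ((3 * x + 0 + 1) * 1)
  identity = solve-∀
-- From 8(3x + 2) = 3(8x + 5) + 1.
... | ((x , suc zero , zero) , e) , refl = ((8 * x + 5 , 0 , 1) , trans (identity x) (cong (8 *_) e)) , refl
  where
  identity : ∀ x → (3 * (8 * x + 5) + 0 + 1) * 1 ≡ 8 * ((3 * x + 2 + 0) * 1)
  identity = solve-∀

form-double : ∀ x a b → form (x * 2) (a * 2) (b * 2) ≡ 8 * form x a b
form-double = identity
  where
  identity : ∀ x a b →
    (3 * (x * 2) + 2 * (a * 2) + b * 2) * (a * 2 * (a * 2) + a * 2 * (b * 2) + b * 2 * (b * 2))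
    ≡ 8 * ((3 * x + 2 * a + b) * (a * a + a * b + b * b))
  identity = solve-∀

double : ∀ {m} → Rep m → Rep (8 * m)
double ((x , a , b) , e) = (x * 2 , a * 2 , b * 2) , trans (form-double x a b) (cong (8 *_) e)

double-injective : ∀ {m} → Injective _≡_ _≡_ (double {m})
double-injective {x = (x , a , b) , _} {(x′ , a′ , b′) , _} eq =
  rep-≡ (cong₂ _,_ (*-cancelʳ-≡ x x′ 2 (cong (proj₁ ∘ proj₁) eq))
      (cong₂ _,_ (*-cancelʳ-≡ a a′ 2 (cong (proj₁ ∘ proj₂ ∘ proj₁) eq))
        (*-cancelʳ-≡ b b′ 2 (cong (proj₂ ∘ proj₂ ∘ proj₁) eq))))

odd-sum : ∀ x a b → 3 * (1 + x * 2) + 2 * (a * 2) + b * 2 ≡ 1 + (1 + (3 * x + 2 * a + b)) * 2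
odd-sum = solve-∀

form-even : ∀ N x a b → form x (a * 2) (b * 2) ≡ 8 ^ N → ∃[ x′ ] x ≡ x′ * 2
form-even N x a b e with x divMod 2
... | result x′ zero refl = x′ , refl
-- For odd `x` the linear factor is odd and at least 3, hence cannot divide `8 ^ N`.
... | result x′ (suc zero) refl
  with () ← odd-divisor-of-8^ (1 + (3 * x′ + 2 * a + b)) N
    (subst₂ _∣_ (odd-sum x′ a b) e (m∣m*n (q (a * 2) (b * 2))))

primitive-or-even : ∀ N (r : Rep (8 ^ N)) →
  Primitive r ⊎ ∃[ x ] ∃[ a ] ∃[ b ] proj₁ r ≡ (x * 2 , a * 2 , b * 2)
primitive-or-even N ((x , a , b) , e) with q-parity a b
... | even a b with x , refl ← form-even N x a b e = inj₂ (x , a , b , refl)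
... | odd t q≡ with refl ← odd-divisor-of-8^ t N (subst₂ _∣_ q≡ e (n∣m*n (3 * x + 2 * a + b)))
  = inj₁ (q≡1⇒a+b≡1 a b q≡)

-- Index `i` stands for the primitive representation of 8 to the power `N - i`, doubled `i` times.
enumerate : ∀ N → Fin (suc N) → Rep (8 ^ N)
enumerate N       zero    = proj₁ (∃-primitive N)
enumerate (suc N) (suc i) = double (enumerate N i)

double-not-primitive : ∀ {m} (r : Rep m) → ¬ Primitive (double r)
double-not-primitive ((_ , a , b) , _) = double≢1 a b

-- Index zero is separated from the others because a doubled representation is never primitive;
-- among the others, doubling can be undone.
enumerate-injective : ∀ N → Injective _≡_ _≡_ (enumerate N)
enumerate-injective N       {zero}  {zero}  _  = refl
enumerate-injective (suc N) {zero}  {suc j} eq =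
  ⊥-elim (double-not-primitive (enumerate N j) (subst Primitive eq (proj₂ (∃-primitive (suc N)))))
enumerate-injective (suc N) {suc i} {zero}  eq =
  ⊥-elim (double-not-primitive (enumerate N i) (subst Primitive (sym eq) (proj₂ (∃-primitive (suc N)))))
enumerate-injective (suc N) {suc i} {suc j} eq =
  cong suc (enumerate-injective N (double-injective eq))

enumerate-surjective : ∀ N → StrictlySurjective _≡_ (enumerate N)
enumerate-surjective N r with primitive-or-even N r
enumerate-surjective N r | inj₁ p = zero , primitive-unique _ r (proj₂ (∃-primitive N)) p
-- With all coordinates even, 1 would be a multiple of 8.
enumerate-surjective zero (_ , e) | inj₂ (x , a , b , refl) =
  contradiction (m*n≡1⇒m≡1 8 (form x a b) (trans (sym (form-double x a b)) e)) λ ()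
enumerate-surjective (suc N) (_ , e) | inj₂ (x , a , b , refl) =
  -- Descent: cancelling 8 makes the halved triple a representation of `8 ^ N`, whose index is then
  -- shifted by one.
  map suc (λ eq → trans (cong double eq) (rep-≡ refl)) (enumerate-surjective N
    ((x , a , b) , *-cancelˡ-≡ _ _ 8 (trans (sym (form-double x a b)) e)))

Fin↔Rep : ∀ N → Fin (suc N) ↔ Rep (8 ^ N)
Fin↔Rep N = ⤖⇒↔ (mk⤖ {to = enumerate N} (enumerate-injective N ,
  strictlySurjective⇒surjective (enumerate-surjective N)))

theorem1 : ∀ (n : ℕ) → n > 0 → ∃[ k ] (k > 0 × ν[ k ]≡ n)
theorem1 (suc N) _ = 8 ^ N , m^n>0 8 N , ↔-trans (Fin↔Rep N) (Rep↔Solution (8 ^ N) {{m^n≢0 8 N}})
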